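{- All cubes in $\mathcal{C}^3_3(v,v,0)$ are of propriety $d=2$, and they are equivalent to Latin squares of order $v$.
   Context: A $v\times v\times v$ array is a function on $\{1,\dots,v\}^3$. A layer is a 2-dimensional subarray obtained by fixing one of the three coordinates. Two layers are parallel if they fix the same coordinate, to different values; their scalar product is the sum over all positions of the product of corresponding entries. $\mathcal{C}^3_3(v,k,\lambda)$ is the set of $v\times v\times v$ arrays over $\{0,1\}$ (called cubes of propriety 3) such that every layer, in each of the three directions, contains exactly $k$ ones and every two parallel layers have scalar product $\lambda$. A cube is of propriety $2$ if, for some $k',\lambda'$, every layer of it is an incidence matrix of a symmetric $(v,k',\lambda')$ design, i.e. a $v\times v$ matrix over $\{0,1\}$ with exactly $k'$ ones in every row and column and with scalar product $\lambda'$ for any two distinct rows and any two distinct columns. A Latin square of order $v$ is a $v\times v$ matrix $L$ over $\{1,\dots,v\}$ in which each symbol appears exactly once in every row and column. The equivalence between cubes $A$ and Latin squares $L$ is understood in the sense of the correspondence $A\leftrightarrow L$ in which $A(x,y,z)=1$ if $L(x,y)=z$, and $A(x,y,z)=0$ otherwise. -}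

module Defs where

open import Algebra.Properties.Semiring.Sum using (sum-syntax)
open import Data.Fin using (Fin; toℕ)
open import Data.Fin.Patterns using (0F; 1F; 2F)
open import Data.Nat using (ℕ; _*_)
open import Data.Nat.Properties using (+-*-semiring)
open import Data.Product using (_×_; _,_; ∃-syntax; ∃!; proj₁)
open import Level using (0ℓ)
open import Relation.Binary.Bundles using (Setoid)
import Relation.Binary.Construct.On as On
open import Relation.Binary.PropositionalEquality using (_≡_; _≢_; _→-setoid_)

-- Coordinates {1,…,v} are rendered as Fin v, and entries {0,1} as Fin 2.

Index² Index³ : ℕ → Set
Index² v = Fin v × Fin v
Index³ v = Fin v × Fin v × Fin v

Row Matrix Cube : ℕ → Set
Row    v = Fin v → Fin 2
Matrix v = Index² v → Fin 2
Cube   v = Index³ v → Fin 2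

private
  Σ-syntax : (n : ℕ) → (Fin n → ℕ) → ℕ
  Σ-syntax = sum-syntax +-*-semiring

  infixl 10 Σ-syntax
  syntax Σ-syntax n (λ i → x) = Σ[ i < n ] x

-- The entries are 0 or 1, so the number of ones is the sum of the entries.

onesRow : ∀ {v} → Row v → ℕ
onesRow {v} a = Σ[ i < v ] toℕ (a i)

onesMatrix : ∀ {v} → Matrix v → ℕ
onesMatrix {v} M = Σ[ i < v ] Σ[ j < v ] toℕ (M (i , j))

dotRow : ∀ {v} → Row v → Row v → ℕ
dotRow {v} a b = Σ[ i < v ] (toℕ (a i) * toℕ (b i))

dotMatrix : ∀ {v} → Matrix v → Matrix v → ℕ
dotMatrix {v} M N = Σ[ i < v ] Σ[ j < v ] (toℕ (M (i , j)) * toℕ (N (i , j)))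

row col : ∀ {v} → Matrix v → Fin v → Row v
row M i = λ j → M (i , j)
col M j = λ i → M (i , j)

-- `layer A d c` fixes the coordinate in direction d to the value c; the
-- remaining two coordinates keep their order.

layer : ∀ {v} → Cube v → Fin 3 → Fin v → Matrix v
layer A 0F c (y , z) = A (c , y , z)
layer A 1F c (x , z) = A (x , c , z)
layer A 2F c (x , y) = A (x , y , c)

record IsPropriety3 (v k λ′ : ℕ) (A : Cube v) : Set where
  field
    layer-ones : ∀ d c → onesMatrix (layer A d c) ≡ k
    layer-dot  : ∀ d {c c′} → c ≢ c′ → dotMatrix (layer A d c) (layer A d c′) ≡ λ′

record IsSymmetricDesign (v k λ′ : ℕ) (M : Matrix v) : Set where
  field
    row-ones : ∀ i → onesRow (row M i) ≡ k
    col-ones : ∀ j → onesRow (col M j) ≡ k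
    row-dot  : ∀ {i i′} → i ≢ i′ → dotRow (row M i) (row M i′) ≡ λ′
    col-dot  : ∀ {j j′} → j ≢ j′ → dotRow (col M j) (col M j′) ≡ λ′

-- The parameters of the design are common to all layers.

IsPropriety2 : ∀ {v} → Cube v → Set
IsPropriety2 {v} A = ∃[ k ] ∃[ λ′ ] (∀ d c → IsSymmetricDesign v k λ′ (layer A d c))

record IsLatinSquare (v : ℕ) (L : Index² v → Fin v) : Set where
  field
    row-once : ∀ x s → ∃! _≡_ (λ y → L (x , y) ≡ s)
    col-once : ∀ y s → ∃! _≡_ (λ x → L (x , y) ≡ s)

-- In both setoids below equality is pointwise equality of the underlying
-- functions; the proofs of the defining conditions are ignored.

-- The set 𝒞³₃(v,k,λ).
𝒞³₃ : (v k λ′ : ℕ) → Setoid 0ℓ 0ℓ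
𝒞³₃ v k λ′ = On.setoid (Index³ v →-setoid Fin 2) (proj₁ {B = IsPropriety3 v k λ′})

LatinSquares : (v : ℕ) → Setoid 0ℓ 0ℓ
LatinSquares v = On.setoid (Index² v →-setoid Fin v) (proj₁ {B = IsLatinSquare v})

record _↔ᴸ_ {v : ℕ} (A : Cube v) (L : Index² v → Fin v) : Set where
  field
    one  : ∀ x y z → L (x , y) ≡ z → A (x , y , z) ≡ 1F
    zero : ∀ x y z → L (x , y) ≢ z → A (x , y , z) ≡ 0F

{-# OPTIONS --safe #-}
-- Since distinct parallel layers of A ∈ 𝒞³₃(v,v,0) are orthogonal, every line
-- of A carries at most one 1.  A layer is the union of v parallel lines and
-- carries v ones, so every line carries exactly one.  Hence every layer is a
-- permutation matrix, i.e. a (v,1,0) design, and A is the graph of the function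
-- L sending (x , y) to the position of the 1 on the line {(x , y , z) | z}; the
-- lines in the other two directions say that L is a Latin square.
module Submission where

open import Defs
open import Algebra.Properties.Semiring.Sum
open import Data.Bool using (if_then_else_)
open import Data.Fin using (Fin; zero; suc; toℕ; _≟_)
open import Data.Fin.Patterns using (0F; 1F; 2F)
open import Data.Fin.Properties using (any?; punchInᵢ≢i)
open import Data.Nat using (ℕ; zero; suc; _+_; _*_; _≤_; z≤n)
open import Data.Nat.Properties
  using (+-*-semiring; +-mono-≤; +-monoʳ-≤; +-cancelʳ-≤; ≤-antisym; ≤-reflexive;
         m+n≡0⇒m≡0; module ≤-Reasoning)
open import Data.Product using (_×_; Σ-syntax; proj₁; proj₂; _,_; ∃!)
open import Data.Vec.Functional using (Vector; removeAt)
open import Function using (_∘_)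
open import Function.Bundles using (Inverse; Equivalence; _⇔_; mk⇔)
open import Function.Construct.Symmetry using (⇔-sym)
open import Relation.Binary.Bundles using (Setoid)
open import Relation.Binary.PropositionalEquality
open import Relation.Nullary using (yes; no; does; contradiction)
open import Relation.Nullary.Decidable using (decidable-stable; dec-true; dec-false)

private
  Σ[_] : ∀ {n} → Vector ℕ n → ℕ
  Σ[_] = sum +-*-semiring

  variable
    v : ℕ

-- Sums of natural numbers with extreme values.

sum-zeros : ∀ {n} {f : Vector ℕ n} → (∀ i → f i ≡ 0) → Σ[ f ] ≡ 0
sum-zeros {n} f≡0 = trans (sum-cong-≗ +-*-semiring f≡0) (sum-replicate-zero +-*-semiring n)

sum-ones : ∀ {n} {f : Vector ℕ n} → (∀ i → f i ≡ 1) → Σ[ f ] ≡ n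
sum-ones {zero}  f≡1 = refl
sum-ones {suc n} f≡1 = cong₂ _+_ (f≡1 zero) (sum-ones (f≡1 ∘ suc))

sum≡0⇒≡0 : ∀ {n} {f : Vector ℕ n} → Σ[ f ] ≡ 0 → ∀ i → f i ≡ 0
sum≡0⇒≡0 {suc n} {f} Σ≡0 i =
  m+n≡0⇒m≡0 (f i) (trans (sym (sum-remove +-*-semiring f)) Σ≡0)

sum≤ : ∀ {n} {f : Vector ℕ n} → (∀ i → f i ≤ 1) → Σ[ f ] ≤ n
sum≤ {zero}  f≤1 = z≤n
sum≤ {suc n} f≤1 = +-mono-≤ (f≤1 zero) (sum≤ (f≤1 ∘ suc))

-- Removing the term `f i` leaves one term fewer than the total, and these remaining terms are each
-- at most 1, so `f i` must supply the missing unit.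
≤1∧sum≡n⇒≡1 : ∀ {n} {f : Vector ℕ n} → (∀ i → f i ≤ 1) → Σ[ f ] ≡ n → ∀ i → f i ≡ 1
≤1∧sum≡n⇒≡1 {suc n} {f} f≤1 Σ≡n i = ≤-antisym (f≤1 i) (+-cancelʳ-≤ n 1 (f i) (begin
  suc n                   ≡⟨ Σ≡n ⟨
  Σ[ f ]                  ≡⟨ sum-remove +-*-semiring f ⟩
  f i + Σ[ removeAt f i ] ≤⟨ +-monoʳ-≤ (f i) (sum≤ (λ _ → f≤1 _)) ⟩
  f i + n                 ∎))
  where open ≤-Reasoning

≢1F⇒≡0F : ∀ {b : Fin 2} → b ≢ 1F → b ≡ 0F
≢1F⇒≡0F {0F} b≢1 = refl
≢1F⇒≡0F {1F} b≢1 = contradiction refl b≢1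

-- Rows with a single 1, and permutation matrices.

Single : Row v → Set
Single a = ∃! _≡_ (λ i → a i ≡ 1F)

-- "At most one 1", phrased through products because these are exactly the summands of the scalar
-- products of layers, rows and columns.
Orthogonal : Row v → Set
Orthogonal a = ∀ {i j} → i ≢ j → toℕ (a i) * toℕ (a j) ≡ 0

single⇒onesRow≡1 : {a : Row v} → Single a → onesRow a ≡ 1
single⇒onesRow≡1 {v = suc v} {a} (i , aᵢ≡1 , i-unique) = begin
  Σ[ toℕ ∘ a ]                                ≡⟨ sum-remove +-*-semiring (toℕ ∘ a) ⟩
  toℕ (a i) + Σ[ removeAt (toℕ ∘ a) i ]       ≡⟨ cong₂ _+_ (cong toℕ aᵢ≡1) (sum-zeros others) ⟩
  1                                           ∎
  where
  open ≡-Reasoning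
  others : ∀ j → removeAt (toℕ ∘ a) i j ≡ 0
  others j = cong toℕ (≢1F⇒≡0F (λ eq → punchInᵢ≢i i j (sym (i-unique eq))))

single⇒orthogonal : {a : Row v} → Single a → Orthogonal a
single⇒orthogonal {a = a} (_ , _ , unique) {i} {j} i≢j with a i in aᵢ | a j in aⱼ
... | 0F | _  = refl
... | 1F | 0F = refl
... | 1F | 1F = contradiction (trans (sym (unique aᵢ)) (unique aⱼ)) i≢j

-- A second 1 at another position would make a product equal to 1, not 0.
orthogonal⇒single : {a : Row v} → Orthogonal a → ∀ {i} → a i ≡ 1F → Single a
orthogonal⇒single {a = a} a⊥ {i} aᵢ≡1 = i , aᵢ≡1 , λ {j} aⱼ≡1 →
  decidable-stable (i ≟ j) λ i≢j →
    contradiction (trans (sym (cong₂ (λ b c → toℕ b * toℕ c) aᵢ≡1 aⱼ≡1)) (a⊥ i≢j)) λ ()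

no-ones⇒onesRow≡0 : {a : Row v} → (∀ i → a i ≢ 1F) → onesRow a ≡ 0
no-ones⇒onesRow≡0 a≢1 = sum-zeros (cong toℕ ∘ ≢1F⇒≡0F ∘ a≢1)

orthogonal⇒onesRow≤1 : {a : Row v} → Orthogonal a → onesRow a ≤ 1
orthogonal⇒onesRow≤1 {a = a} a⊥ with any? (λ i → a i ≟ 1F)
... | yes (i , aᵢ≡1) = ≤-reflexive (single⇒onesRow≡1 (orthogonal⇒single a⊥ aᵢ≡1))
... | no  ∄1         = subst (_≤ 1) (sym (no-ones⇒onesRow≡0 λ i aᵢ≡1 → ∄1 (i , aᵢ≡1))) z≤n

onesRow≡1⇒single : {a : Row v} → Orthogonal a → onesRow a ≡ 1 → Single a
onesRow≡1⇒single {a = a} a⊥ ones≡1 with any? (λ i → a i ≟ 1F)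
... | yes (i , aᵢ≡1) = orthogonal⇒single a⊥ aᵢ≡1
... | no  ∄1         =
  contradiction (trans (sym ones≡1) (no-ones⇒onesRow≡0 λ i aᵢ≡1 → ∄1 (i , aᵢ≡1))) λ ()

record IsPermutationMatrix (M : Matrix v) : Set where
  field
    row-single : ∀ i → Single (row M i)
    col-single : ∀ j → Single (col M j)

permutationMatrix⇒design : {M : Matrix v} → IsPermutationMatrix M → IsSymmetricDesign v 1 0 M
permutationMatrix⇒design perm = record
  { row-ones = single⇒onesRow≡1 ∘ row-single
  ; col-ones = single⇒onesRow≡1 ∘ col-single
  -- The j-th summand for two rows multiplies two entries of column j, so the columns control the
  -- row products, and vice versa.
  ; row-dot  = λ i≢i′ → sum-zeros λ j → single⇒orthogonal (col-single j) i≢i′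
  ; col-dot  = λ j≢j′ → sum-zeros λ i → single⇒orthogonal (row-single i) j≢j′
  }
  where open IsPermutationMatrix perm

-- Cubes in which every line carries a single 1.

-- A line is perpendicular to the layers of direction `d`: it keeps the position `p` within a layer
-- and lets the layer vary.
line : Cube v → Fin 3 → Index² v → Row v
line A d p c = layer A d c p

LinesSingle : Cube v → Set
LinesSingle A = ∀ d p → Single (line A d p)

-- The rows and columns of a layer are the lines in the two directions other than `d`.
layer-permutation : {A : Cube v} → LinesSingle A → ∀ d c → IsPermutationMatrix (layer A d c)
layer-permutation single 0F x = record
  { row-single = λ y → single 2F (x , y) ; col-single = λ z → single 1F (x , z) }
layer-permutation single 1F y = record
  { row-single = λ x → single 2F (x , y) ; col-single = λ z → single 0F (y , z) }
layer-permutation single 2F z = record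
  { row-single = λ x → single 1F (x , z) ; col-single = λ y → single 0F (y , z) }

linesSingle⇒propriety2 : {A : Cube v} → LinesSingle A → IsPropriety2 A
linesSingle⇒propriety2 single =
  1 , 0 , λ d c → permutationMatrix⇒design (layer-permutation single d c)

linesSingle⇒propriety3 : {A : Cube v} → LinesSingle A → IsPropriety3 v v 0 A
linesSingle⇒propriety3 single = record
  { layer-ones = λ d c → sum-ones (single⇒onesRow≡1 ∘ row-single (layer-permutation single d c))
  ; layer-dot  = λ d c≢c′ → sum-zeros λ i → sum-zeros λ j → single⇒orthogonal (single d (i , j)) c≢c′
  }
  where open IsPermutationMatrix

propriety3⇒linesSingle : {A : Cube v} → IsPropriety3 v v 0 A → LinesSingle A
propriety3⇒linesSingle {v} {A} prop d p = onesRow≡1⇒single (lines-orthogonal d p) (line-ones d p)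
  where
  open IsPropriety3 prop

  lines-orthogonal : ∀ d p → Orthogonal (line A d p)
  -- As λ = 0, a vanishing sum of naturals forces each single product to vanish.
  lines-orthogonal d (i , j) c≢c′ = sum≡0⇒≡0 (sum≡0⇒≡0 (layer-dot d c≢c′) i) j

  line-ones : ∀ d p → onesRow (line A d p) ≡ 1
  line-ones 0F (y , z) = ≤1∧sum≡n⇒≡1
    (λ y → orthogonal⇒onesRow≤1 (lines-orthogonal 0F (y , z)))
    -- In each layer that contains a line of direction `0F`, x is the outer summation index, so the
    -- double sum is exchanged before it splits into such lines.
    (trans (∑-comm +-*-semiring (λ y x → toℕ (A (x , y , z)))) (layer-ones 2F z)) y
  line-ones 1F (x , z) = ≤1∧sum≡n⇒≡1
    (λ x → orthogonal⇒onesRow≤1 (lines-orthogonal 1F (x , z))) (layer-ones 2F z) x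
  line-ones 2F (x , y) = ≤1∧sum≡n⇒≡1
    (λ y → orthogonal⇒onesRow≤1 (lines-orthogonal 2F (x , y))) (layer-ones 0F x) y

-- The correspondence between cubes and Latin squares.

∃!-cong : {P Q : Fin v → Set} → (∀ i → P i ⇔ Q i) → ∃! _≡_ P → ∃! _≡_ Q
∃!-cong P⇔Q (i , pᵢ , unique) =
  i , Equivalence.to (P⇔Q i) pᵢ , λ {j} → unique ∘ Equivalence.from (P⇔Q j)

-- The converse of `one` comes from `zero`, since equality in `Fin v` is decidable. As an
-- equivalence, the correspondence transports unique existence between lines of the cube and the
-- square.
↔ᴸ⇒⇔ : {A : Cube v} {L : Index² v → Fin v} → A ↔ᴸ L →
       ∀ x y z → (A (x , y , z) ≡ 1F) ⇔ (L (x , y) ≡ z)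
↔ᴸ⇒⇔ {L = L} A↔L x y z = mk⇔
  (λ A≡1 → decidable-stable (L (x , y) ≟ z) λ L≢z →
    contradiction (trans (sym A≡1) (_↔ᴸ_.zero A↔L x y z L≢z)) λ ())
  (_↔ᴸ_.one A↔L x y z)

module _ {A A′ : Cube v} {L L′ : Index² v → Fin v} (A↔L : A ↔ᴸ L) (A′↔L′ : A′ ↔ᴸ L′) where

  -- Together with `↔ᴸ-injective`, this says that each side of the correspondence determines the
  -- other; the congruences and inverse laws of the bijection are instances of the two.
  ↔ᴸ-functional : A ≗ A′ → L ≗ L′
  ↔ᴸ-functional A≗A′ (x , y) = sym (Equivalence.to (↔ᴸ⇒⇔ A′↔L′ x y _)
    (trans (sym (A≗A′ _)) (_↔ᴸ_.one A↔L x y _ refl)))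

  ↔ᴸ-injective : L ≗ L′ → A ≗ A′
  ↔ᴸ-injective L≗L′ (x , y , z) with L (x , y) ≟ z
  ... | yes L≡z = trans (_↔ᴸ_.one A↔L x y z L≡z)
                        (sym (_↔ᴸ_.one A′↔L′ x y z (trans (sym (L≗L′ _)) L≡z)))
  ... | no  L≢z = trans (_↔ᴸ_.zero A↔L x y z L≢z)
                        (sym (_↔ᴸ_.zero A′↔L′ x y z (L≢z ∘ trans (L≗L′ _))))

module _ {A : Cube v} {L : Index² v → Fin v} (A↔L : A ↔ᴸ L) where

  linesSingle⇒latin : LinesSingle A → IsLatinSquare v L
  linesSingle⇒latin single = record
    { row-once = λ x s → ∃!-cong (λ y → ↔ᴸ⇒⇔ A↔L x y s) (single 1F (x , s))
    ; col-once = λ y s → ∃!-cong (λ x → ↔ᴸ⇒⇔ A↔L x y s) (single 0F (y , s))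
    }

  latin⇒linesSingle : IsLatinSquare v L → LinesSingle A
  latin⇒linesSingle latin 0F (y , z) =
    ∃!-cong (λ x → ⇔-sym (↔ᴸ⇒⇔ A↔L x y z)) (IsLatinSquare.col-once latin y z)
  latin⇒linesSingle latin 1F (x , z) =
    ∃!-cong (λ y → ⇔-sym (↔ᴸ⇒⇔ A↔L x y z)) (IsLatinSquare.row-once latin x z)
  latin⇒linesSingle latin 2F (x , y) =
    -- Along direction `2F` the unique 1 only expresses that `L` is a function.
    ∃!-cong (λ z → ⇔-sym (↔ᴸ⇒⇔ A↔L x y z)) (L (x , y) , refl , λ L≡z → L≡z)

toSquare : {A : Cube v} → LinesSingle A → Index² v → Fin v
toSquare single p = proj₁ (single 2F p)

↔ᴸ-toSquare : {A : Cube v} (single : LinesSingle A) → A ↔ᴸ toSquare single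
↔ᴸ-toSquare {A = A} single = record
  { one  = λ x y z L≡z → subst (λ z → A (x , y , z) ≡ 1F) L≡z (proj₁ (proj₂ (single 2F (x , y))))
  ; zero = λ x y z L≢z → ≢1F⇒≡0F (L≢z ∘ proj₂ (proj₂ (single 2F (x , y))))
  }

toCube : (Index² v → Fin v) → Cube v
toCube L (x , y , z) = if does (L (x , y) ≟ z) then 1F else 0F

toCube-↔ᴸ : (L : Index² v → Fin v) → toCube L ↔ᴸ L
toCube-↔ᴸ L = record
  { one  = λ x y z L≡z → cong (if_then 1F else 0F) (dec-true (L (x , y) ≟ z) L≡z)
  ; zero = λ x y z L≢z → cong (if_then 1F else 0F) (dec-false (L (x , y) ≟ z) L≢z)
  }

cubes↔latinSquares : ∀ v → Inverse (𝒞³₃ v v 0) (LatinSquares v)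
cubes↔latinSquares v = record
  { to        = to
  ; from      = from
  ; to-cong   = λ {A} {A′} → ↔ᴸ-functional (graph A) (graph A′)
  ; from-cong = λ {(L , _)} {(L′ , _)} → ↔ᴸ-injective (toCube-↔ᴸ L) (toCube-↔ᴸ L′)
  -- Each inverse law assumes a setoid equality on one side and asks for one on the other, which is
  -- the shape of the two determination lemmas.
  ; inverse   = (λ {(L , _)} {A} → ↔ᴸ-functional (graph A) (toCube-↔ᴸ L))
              , (λ {A} {(L , _)} → ↔ᴸ-injective (toCube-↔ᴸ L) (graph A))
  }
  where
  open Setoid
  to : Carrier (𝒞³₃ v v 0) → Carrier (LatinSquares v)
  to (A , prop) = toSquare single , linesSingle⇒latin (↔ᴸ-toSquare single) single
    where single = propriety3⇒linesSingle prop

  from : Carrier (LatinSquares v) → Carrier (𝒞³₃ v v 0)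
  from (L , latin) = toCube L , linesSingle⇒propriety3 (latin⇒linesSingle (toCube-↔ᴸ L) latin)

  graph : ∀ A → proj₁ A ↔ᴸ proj₁ (to A)
  graph (A , prop) = ↔ᴸ-toSquare (propriety3⇒linesSingle prop)

proposition2p7 : ∀ (v : ℕ) →
    (∀ (A : Cube v) → IsPropriety3 v v 0 A → IsPropriety2 A)
    ×
    (Σ[ f ∈ Inverse (𝒞³₃ v v 0) (LatinSquares v) ]
    (∀ (A : Setoid.Carrier (𝒞³₃ v v 0)) → proj₁ A ↔ᴸ proj₁ (Inverse.to f A)))
proposition2p7 v =
  (λ A → linesSingle⇒propriety2 ∘ propriety3⇒linesSingle) ,
  cubes↔latinSquares v ,
  λ (A , prop) → ↔ᴸ-toSquare (propriety3⇒linesSingle prop)
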